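{- Let $n \geq 1$ be a positive integer. There exists a $\chi_g$-upper-game-vertex-critical graph $G$ such that $$\left\{\chi_g(G)-\chi_g(G-x) \, | \, x \in V(G)\right\}=\{ -1,-n\}.$$
   Context: All graphs are simple, undirected and finite. The coloring game on a graph $G$ with color set $\{1,\ldots,k\}$ is played by Alice and Bob. Alice moves first and the players alternate turns; in each turn the player colors a previously uncolored vertex with a color from $\{1,\ldots,k\}$ different from the colors already given to its neighbors. If at some point there is an uncolored vertex having all colors $1,\ldots,k$ in its neighborhood, Bob wins; otherwise, if all vertices get colored, Alice wins. The game chromatic number $\chi_g(G)$ is the minimum $k$ for which Alice has a winning strategy on $G$. For $x\in V(G)$, $G-x$ is the graph obtained from $G$ by deleting $x$ and all edges incident with $x$. A graph $G$ is $\chi_g$-upper-game-vertex-critical if $\chi_g(G-x)>\chi_g(G)$ for every $x\in V(G)$. -}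

module Defs where

open import Data.Empty using (⊥-elim)
open import Data.Fin.Base using (Fin; zero; suc; punchIn; punchOut)
import Data.Fin.Properties as Fin
open import Data.Integer.Base as ℤ using (ℤ; +_)
open import Data.Maybe.Base using (Maybe; just; nothing)
import Data.Maybe.Properties as Maybe
open import Data.Nat.Base using (ℕ; zero; suc; pred; _≤_; _<_; _>_; z≤n; s≤s)
import Data.Nat.Properties as ℕ
open import Data.Product.Base using (∃; ∃-syntax; _×_; _,_; proj₁; proj₂)
open import Data.Vec.Base using (Vec; []; _∷_; lookup; replicate; _[_]≔_)
open import Function.Base using (_∘_)
open import Level using (0ℓ)
open import Relation.Binary.Core using (Rel)
open import Relation.Binary.Definitions using (Decidable; Irreflexive; Symmetric)
open import Relation.Binary.PropositionalEquality
  using (_≡_; _≢_; refl; sym; trans; cong)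
open import Relation.Nullary.Decidable
  using (Dec; yes; no; map′; ¬?; _×-dec_)
open import Relation.Nullary.Negation using (¬_)
open import Relation.Unary using (Pred)

record Graph (n : ℕ) : Set₁ where
  field
    Adj    : Rel (Fin n) 0ℓ
    adj?   : Decidable Adj
    symm   : Symmetric Adj
    irrefl : Irreflexive _≡_ Adj

open Graph public

-- The vertices of G ∖ x are renumbered so as to skip x.
infixl 6 _∖_
_∖_ : ∀ {n} → Graph n → Fin n → Graph (pred n)
_∖_ {suc n} G x = record
  { Adj    = λ u v → Adj G (punchIn x u) (punchIn x v)
  ; adj?   = λ u v → adj? G (punchIn x u) (punchIn x v)
  ; symm   = symm G
  ; irrefl = irrefl G ∘ cong (punchIn x)
  }

PartialColouring : ℕ → ℕ → Set
PartialColouring k n = Vec (Maybe (Fin k)) n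

data Player : Set where
  alice bob : Player

module _ {n : ℕ} (G : Graph n) {k : ℕ} where

  Uncoloured : PartialColouring k n → Fin n → Set
  Uncoloured c v = lookup c v ≡ nothing

  AllColoured : PartialColouring k n → Set
  AllColoured c = ∀ v → ¬ Uncoloured c v

  SeesColour : PartialColouring k n → Fin n → Fin k → Set
  SeesColour c v a = ∃[ u ] Adj G v u × lookup c u ≡ just a

  LegalMove : PartialColouring k n → Fin n → Fin k → Set
  LegalMove c v a = Uncoloured c v × ¬ SeesColour c v a

  Blocked : PartialColouring k n → Set
  Blocked c = ∃[ v ] Uncoloured c v × (∀ a → SeesColour c v a)

  -- An element of AliceWins p c is a winning strategy for Alice, presented as
  -- its game tree, from position c with player p to move.
  data AliceWins : Player → PartialColouring k n → Set where
    finished  : ∀ {p c} → AllColoured c → AliceWins p c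
    aliceMove : ∀ {c} → ¬ Blocked c →
                ∀ v a → LegalMove c v a → AliceWins bob (c [ v ]≔ just a) →
                AliceWins alice c
    bobMove   : ∀ {c} → ¬ Blocked c →
                (∀ v a → LegalMove c v a → AliceWins alice (c [ v ]≔ just a)) →
                AliceWins bob c

AliceHasWinningStrategy : ∀ {n} → Graph n → ℕ → Set
AliceHasWinningStrategy {n} G k = AliceWins G {k} alice (replicate n nothing)

IsMinimum : Pred ℕ 0ℓ → ℕ → Set
IsMinimum P k = P k × (∀ j → P j → k ≤ j)

IsGameChromaticNumber : ∀ {n} → Graph n → ℕ → Set
IsGameChromaticNumber G = IsMinimum (AliceHasWinningStrategy G)

uncolouredCount : ∀ {k n} → PartialColouring k n → ℕ
uncolouredCount []            = 0
uncolouredCount (just _  ∷ c) = uncolouredCount c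
uncolouredCount (nothing ∷ c) = suc (uncolouredCount c)

count-update : ∀ {k n} (c : PartialColouring k n) v a → lookup c v ≡ nothing →
               uncolouredCount (c [ v ]≔ just a) < uncolouredCount c
count-update (nothing ∷ c) zero    a eq = ℕ.≤-refl
count-update (just _  ∷ c) (suc v) a eq = count-update c v a eq
count-update (nothing ∷ c) (suc v) a eq = s≤s (count-update c v a eq)

count-decreases : ∀ {k n f} (c : PartialColouring k n) v a → lookup c v ≡ nothing →
                  uncolouredCount c ≤ suc f →
                  uncolouredCount (c [ v ]≔ just a) ≤ f
count-decreases c v a eq le = ℕ.≤-pred (ℕ.≤-trans (count-update c v a eq) le)

count-zero : ∀ {k n} (c : PartialColouring k n) → uncolouredCount c ≤ 0 →
             ∀ v → lookup c v ≢ nothing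
count-zero (just _  ∷ c) le zero    ()
count-zero (just _  ∷ c) le (suc v) eq = count-zero c le v eq
count-zero (nothing ∷ c) ()

module _ {n : ℕ} (G : Graph n) {k : ℕ} where

  uncoloured? : ∀ (c : PartialColouring k n) v → Dec (Uncoloured G c v)
  uncoloured? c v = Maybe.≡-dec Fin._≟_ (lookup c v) nothing

  allColoured? : ∀ (c : PartialColouring k n) → Dec (AllColoured G c)
  allColoured? c = Fin.all? (λ v → ¬? (uncoloured? c v))

  seesColour? : ∀ (c : PartialColouring k n) v a → Dec (SeesColour G c v a)
  seesColour? c v a = Fin.any? λ u →
    adj? G v u ×-dec Maybe.≡-dec Fin._≟_ (lookup c u) (just a)

  legalMove? : ∀ (c : PartialColouring k n) v a → Dec (LegalMove G c v a)
  legalMove? c v a = uncoloured? c v ×-dec ¬? (seesColour? c v a)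

  blocked? : ∀ (c : PartialColouring k n) → Dec (Blocked G c)
  blocked? c = Fin.any? λ v → uncoloured? c v ×-dec Fin.all? (seesColour? c v)

  aliceWins? : ∀ f p (c : PartialColouring k n) → uncolouredCount c ≤ f →
               Dec (AliceWins G p c)
  aliceWins? zero    p c le = yes (finished (count-zero c le))
  aliceWins? (suc f) p c le with allColoured? c | blocked? c
  ... | yes all | _        = yes (finished all)
  ... | no ¬all | yes blkd = no λ where
    (finished all)            → ¬all all
    (aliceMove ¬blkd _ _ _ _) → ¬blkd blkd
    (bobMove ¬blkd _)         → ¬blkd blkd
  aliceWins? (suc f) alice c le | no ¬all | no ¬blkd = map′
    (λ (v , a , l , w) → aliceMove ¬blkd v a l w)
    (λ where
      (finished all)        → ⊥-elim (¬all all)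
      (aliceMove _ v a l w) → v , a , l , w)
    (Fin.any? λ v → Fin.any? λ a → move? v a)
    where
    move? : ∀ v a → Dec (LegalMove G c v a × AliceWins G bob (c [ v ]≔ just a))
    move? v a with legalMove? c v a
    ... | no ¬l = no (¬l ∘ proj₁)
    ... | yes l = map′ (l ,_) proj₂
      (aliceWins? f bob _ (count-decreases c v a (proj₁ l) le))
  aliceWins? (suc f) bob c le | no ¬all | no ¬blkd = map′
    (bobMove ¬blkd)
    (λ where
      (finished all) → ⊥-elim (¬all all)
      (bobMove _ w)  → w)
    (Fin.all? λ v → Fin.all? λ a → reply? v a)
    where
    reply? : ∀ v a → Dec (LegalMove G c v a → AliceWins G alice (c [ v ]≔ just a))
    reply? v a with legalMove? c v a
    ... | no ¬l = yes (⊥-elim ∘ ¬l)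
    ... | yes l = map′ (λ w _ → w) (λ w → w l)
      (aliceWins? f alice _ (count-decreases c v a (proj₁ l) le))

aliceHasWinningStrategy? : ∀ {n} (G : Graph n) k → Dec (AliceHasWinningStrategy G k)
aliceHasWinningStrategy? G k = aliceWins? G _ alice _ ℕ.≤-refl

-- With as many colours as vertices, the neighbours of an uncoloured vertex
-- are too few to show every colour.
¬blocked : ∀ {n} (G : Graph n) (c : PartialColouring n n) → ¬ Blocked G c
¬blocked {suc n} G c (v , uncol , sees) = Fin.<⇒notInjective ℕ.≤-refl injective
  where
  v≢ : ∀ a → v ≢ proj₁ (sees a)
  v≢ a eq = irrefl G eq (proj₁ (proj₂ (sees a)))

  f : Fin (suc n) → Fin n
  f a = punchOut (v≢ a)

  injective : ∀ {a b} → f a ≡ f b → a ≡ b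
  injective {a} {b} eq = Maybe.just-injective
    (trans (sym (proj₂ (proj₂ (sees a))))
    (trans (cong (lookup c) (Fin.punchOut-injective (v≢ a) (v≢ b) eq))
           (proj₂ (proj₂ (sees b)))))

enoughColours : ∀ {n} (G : Graph n) f p (c : PartialColouring n n) →
                uncolouredCount c ≤ f → AliceWins G p c
enoughColours G zero    p     c le = finished (count-zero c le)
enoughColours G (suc f) bob   c le = bobMove (¬blocked G c) λ v a l →
  enoughColours G f alice _ (count-decreases c v a (proj₁ l) le)
enoughColours {n} G (suc f) alice c le with Fin.any? (uncoloured? G c)
... | no ¬∃         = finished (λ v uncol → ¬∃ (v , uncol))
... | yes (v , uncol) =
  let a , free = Fin.¬∀⟶∃¬ n _ (seesColour? G c v)
                   (λ sees → ¬blocked G c (v , uncol , sees))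
  in aliceMove (¬blocked G c) v a (uncol , free)
       (enoughColours G f bob _ (count-decreases c v a uncol le))

minimum : ∀ {P : Pred ℕ 0ℓ} → (∀ k → Dec (P k)) → ∀ m → P m → ∃ (IsMinimum P)
minimum P? zero    pm = zero , pm , λ _ _ → z≤n
minimum P? (suc m) pm with P? zero
... | yes p0 = zero , p0 , λ _ _ → z≤n
... | no ¬p0 with minimum (P? ∘ suc) m pm
...   | k , pk , least = suc k , pk , λ where
  zero    p0 → ⊥-elim (¬p0 p0)
  (suc j) pj → s≤s (least j pj)

-- Opaque so that type checking never runs the exhaustive game search.
opaque
  gameChromaticNumber : ∀ {n} (G : Graph n) → ∃ (IsGameChromaticNumber G)
  gameChromaticNumber {n} G =
    minimum (aliceHasWinningStrategy? G) n (enoughColours G _ alice _ ℕ.≤-refl)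

χg : ∀ {n} → Graph n → ℕ
χg G = proj₁ (gameChromaticNumber G)

χg-isGameChromaticNumber : ∀ {n} (G : Graph n) → IsGameChromaticNumber G (χg G)
χg-isGameChromaticNumber G = proj₂ (gameChromaticNumber G)

UpperGameVertexCritical : ∀ {n} → Graph n → Set
UpperGameVertexCritical G = ∀ x → χg (G ∖ x) > χg G

χgDifferences : ∀ {n} → Graph n → Pred ℤ 0ℓ
χgDifferences G z = ∃[ x ] z ≡ + χg G ℤ.- + χg (G ∖ x)

{-# OPTIONS --safe #-}
module Submission where

-- G is the crown K_{m,m} minus a perfect matching, m = n + 2, plus an isolated
-- vertex, and the vertex vtx s i is matched with vtx (not s) i.
-- In G Alice wastes her first move on the isolated vertex and answers Bob's
-- first move in the crown by giving the other colour to the matched vertex;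
-- together these two vertices force all the others, so χg G = 2.
-- In the crown itself Bob is the one who answers, repeating each of Alice's
-- colours on the matched vertex, so every matching edge uses a new colour and
-- χg = m. If vtx s i is deleted, its mate vtx (not s) i is adjacent to its whole
-- opposite side; two colours no longer suffice, but three do if Alice starts there.

open import Defs
open import Data.Bool.Base using (Bool; true; false; not)
import Data.Bool.Properties as Bool
open import Data.Empty using (⊥; ⊥-elim)
open import Data.Fin.Base using (Fin; zero; suc; punchIn; punchOut; splitAt; _↑ˡ_; _↑ʳ_)
import Data.Fin.Properties as Fin
open import Data.Integer.Base as ℤ using (+_; -_)
open import Data.Maybe.Base using (just; nothing)
open import Data.Maybe.Properties using (just-injective)
open import Data.Nat.Base using (ℕ; zero; suc; _+_; _≤_; _≥_; z≤n; s≤s)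
import Data.Nat.Properties as ℕ
open import Data.Product.Base using (∃-syntax; Σ-syntax; _×_; _,_; proj₁; proj₂)
open import Data.Sum.Base using (_⊎_; inj₁; inj₂; [_,_]′)
open import Data.Unit.Base using (⊤; tt)
open import Data.Vec.Base using (lookup; replicate; _[_]≔_)
open import Data.Vec.Properties using (lookup∘update; lookup∘update′; lookup-replicate)
open import Function.Base using (_∘_; case_of_)
open import Relation.Binary.PropositionalEquality
  using (_≡_; _≢_; refl; sym; trans; cong; cong₂; subst; ≢-sym)
open import Relation.Nullary.Decidable using (Dec; yes; no; map′; ¬?; _×-dec_)
open import Relation.Nullary.Negation using (¬_)
open import Relation.Unary using (_≐_; _∪_; ｛_｝)

-- Small sets of colours and indices

third : ∀ {r} (i j : Fin (3 + r)) → ∃[ l ] l ≢ i × l ≢ j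
third zero          zero          = suc zero , (λ ()) , (λ ())
third zero          (suc zero)    = suc (suc zero) , (λ ()) , (λ ())
third zero          (suc (suc _)) = suc zero , (λ ()) , (λ ())
third (suc zero)    zero          = suc (suc zero) , (λ ()) , (λ ())
third (suc (suc _)) zero          = suc zero , (λ ()) , (λ ())
third (suc _)       (suc _)       = zero , (λ ()) , (λ ())

opposite : Fin 2 → Fin 2
opposite x = punchIn x zero

opposite-≢ : ∀ x → opposite x ≢ x
opposite-≢ x = Fin.punchInᵢ≢i x zero

≡⊎≡opposite : ∀ x y → y ≡ x ⊎ y ≡ opposite x
≡⊎≡opposite zero       zero       = inj₁ refl
≡⊎≡opposite zero       (suc zero) = inj₂ refl
≡⊎≡opposite (suc zero) zero       = inj₂ refl
≡⊎≡opposite (suc zero) (suc zero) = inj₁ refl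

≢⇒2≤ : ∀ {k} {x y : Fin k} → x ≢ y → 2 ≤ k
≢⇒2≤ {suc zero}    {zero} {zero} x≢y = ⊥-elim (x≢y refl)
≢⇒2≤ {suc (suc k)} x≢y = s≤s (s≤s z≤n)

-- The colouring game on an arbitrary graph

module _ {n k : ℕ} (c : PartialColouring k n) where

  colour-persists : ∀ {u v a x} → lookup c v ≡ nothing → lookup c u ≡ just x →
                    lookup (c [ v ]≔ just a) u ≡ just x
  colour-persists {u} {v} {a} uncol eq with u Fin.≟ v
  ... | yes refl = case trans (sym eq) uncol of λ ()
  ... | no u≢v   = trans (lookup∘update′ u≢v c (just a)) eq

  colour-before : ∀ {u v a x} → lookup (c [ v ]≔ just a) u ≡ just x →
                  (u ≡ v × a ≡ x) ⊎ lookup c u ≡ just x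
  colour-before {u} {v} {a} eq with u Fin.≟ v
  ... | yes refl = inj₁ (refl , just-injective (trans (sym (lookup∘update v c (just a))) eq))
  ... | no u≢v   = inj₂ (trans (sym (lookup∘update′ u≢v c (just a))) eq)

  uncoloured-before : ∀ {u v a} → lookup (c [ v ]≔ just a) u ≡ nothing →
                      u ≢ v × lookup c u ≡ nothing
  uncoloured-before {u} {v} {a} eq with u Fin.≟ v
  ... | yes refl = case trans (sym (lookup∘update v c (just a))) eq of λ ()
  ... | no u≢v   = u≢v , trans (sym (lookup∘update′ u≢v c (just a))) eq

  uncoloured-after : ∀ {u v a} → u ≢ v → lookup c u ≡ nothing →
                     lookup (c [ v ]≔ just a) u ≡ nothing
  uncoloured-after {a = a} u≢v eq = trans (lookup∘update′ u≢v c (just a)) eq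

coloured : ∀ {n k} (c : PartialColouring k n) u → lookup c u ≢ nothing →
           ∃[ x ] lookup c u ≡ just x
coloured c u ≢nothing with lookup c u
... | just x  = x , refl
... | nothing = ⊥-elim (≢nothing refl)

module _ {n : ℕ} (G : Graph n) {k : ℕ} where

  sees-persists : ∀ (c : PartialColouring k n) {u v a x} → lookup c v ≡ nothing →
                  SeesColour G c u x → SeesColour G (c [ v ]≔ just a) u x
  sees-persists c uncol (w , adj , eq) = w , adj , colour-persists c uncol eq

  Proper : PartialColouring k n → Set
  Proper c = ∀ u v x → Adj G u v → lookup c u ≡ just x → lookup c v ≢ just x

  empty-proper : Proper (replicate n nothing)
  empty-proper u _ _ _ eq _ = case trans (sym (lookup-replicate u nothing)) eq of λ ()

  proper-update : ∀ c {v a} → Proper c → LegalMove G c v a → Proper (c [ v ]≔ just a)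
  proper-update c prop (_ , unseen) u w x adj equ eqw
    with colour-before c equ | colour-before c eqw
  ... | inj₁ (refl , refl) | inj₁ (refl , _)    = irrefl G refl adj
  ... | inj₁ (refl , refl) | inj₂ eqw′          = unseen (w , adj , eqw′)
  ... | inj₂ equ′          | inj₁ (refl , refl) = unseen (u , symm G adj , equ′)
  ... | inj₂ equ′          | inj₂ eqw′          = prop u w x adj equ′ eqw′

  uncoloured⇒legalMove : ∀ (c : PartialColouring k n) {v} → ¬ Blocked G c →
                         Uncoloured G c v → ∃[ a ] LegalMove G c v a
  uncoloured⇒legalMove c {v} ¬blkd uncol =
    let a , unseen = Fin.¬∀⟶∃¬ k _ (seesColour? G c v) (λ sees → ¬blkd (v , uncol , sees))
    in a , uncol , unseen

  blocked-loses : ∀ {p} {c : PartialColouring k n} → Blocked G c → ¬ AliceWins G p c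
  blocked-loses (v , uncol , _) (finished all)            = all v uncol
  blocked-loses blkd            (aliceMove ¬blkd _ _ _ _) = ¬blkd blkd
  blocked-loses blkd            (bobMove ¬blkd _)         = ¬blkd blkd

  -- Follow any one line of play through the strategy tree. The colouring stays proper, so when
  -- everything is coloured the two ends of the edge carry different colours. At Bob's turns a
  -- continuation exists because the position is not blocked.
  edge⇒2≤k : ∀ {p c u v} → Adj G u v → Proper c → AliceWins G p c → 2 ≤ k
  edge⇒2≤k {c = c} {u} {v} adj prop (finished all) =
    let x , equ = coloured c u (all u)
        y , eqv = coloured c v (all v)
    in ≢⇒2≤ {x = x} {y} (λ x≡y → prop u v x adj equ (trans eqv (cong just (sym x≡y))))
  edge⇒2≤k {c = c} adj prop (aliceMove _ _ _ l win) =
    edge⇒2≤k adj (proper-update c prop l) win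
  edge⇒2≤k {c = c} adj prop (bobMove ¬blkd win) with Fin.any? (uncoloured? G c)
  ... | no ¬∃ = edge⇒2≤k {p = bob} {c} adj prop (finished (λ v uncol → ¬∃ (v , uncol)))
  ... | yes (v , uncol) =
    let a , l = uncoloured⇒legalMove c ¬blkd uncol
    in edge⇒2≤k adj (proper-update c prop l) (win v a l)

  module _ (I : PartialColouring k n → Set)
           (I⇒¬blocked : ∀ c → I c → ¬ Blocked G c)
           (I-update : ∀ c {v a} → I c → LegalMove G c v a → I (c [ v ]≔ just a))
           where

    -- Since `I` survives every legal move of either player, Alice needs no strategy: any legal move
    -- will do, and one exists as long as a vertex is uncoloured. The induction is on a bound for
    -- the number of uncoloured vertices.
    invariantWins : ∀ {p c} → I c → AliceWins G p c
    invariantWins = go _ _ _ ℕ.≤-refl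
      where
      go : ∀ f p c → uncolouredCount c ≤ f → I c → AliceWins G p c
      go zero    p     c le inv = finished (count-zero c le)
      go (suc f) bob   c le inv = bobMove (I⇒¬blocked c inv) λ v a l →
        go f alice _ (count-decreases c v a (proj₁ l) le) (I-update c inv l)
      go (suc f) alice c le inv with Fin.any? (uncoloured? G c)
      ... | no ¬∃ = finished (λ v uncol → ¬∃ (v , uncol))
      ... | yes (v , uncol) =
        let a , l = uncoloured⇒legalMove c (I⇒¬blocked c inv) uncol
        in aliceMove (I⇒¬blocked c inv) v a l
             (go f bob _ (count-decreases c v a uncol le) (I-update c inv l))

-- Bob's winning threat with two colours: `w` already sees `x` at `u`, and colouring its neighbour
-- `v` with the other colour leaves nothing for `w`.
fork : ∀ {n} (G : Graph n) {c : PartialColouring 2 n} {u v w x} →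
       Uncoloured G c w → Adj G w u → lookup c u ≡ just x →
       Adj G w v → LegalMove G c v (opposite x) → ¬ AliceWins G bob c
fork G {w = w} uncol adju equ adjv l (finished all) = all w uncol
fork G {c} {u} {v} {w} {x} uncol adju equ adjv l@(uncolv , _) (bobMove _ win) =
  blocked-loses G (w , uncolw , sees) (win v (opposite x) l)
  where
  uncolw : Uncoloured G (c [ v ]≔ just (opposite x)) w
  uncolw = uncoloured-after c (λ eq → irrefl G eq adjv) uncol

  sees : ∀ a → SeesColour G (c [ v ]≔ just (opposite x)) w a
  sees a with ≡⊎≡opposite x a
  ... | inj₁ refl = u , adju , colour-persists c uncolv equ
  ... | inj₂ refl = v , adjv , lookup∘update v c _

χg-unique : ∀ {n} {G : Graph n} {k} → IsGameChromaticNumber G k → χg G ≡ k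
χg-unique {G = G} (wins , least) =
  let wins′ , least′ = χg-isGameChromaticNumber G
  in ℕ.≤-antisym (least′ _ wins) (least _ wins′)

-- Crown graphs with an isolated vertex

data Vertex (m : ℕ) : Set where
  isolated : Vertex m
  vtx      : Bool → Fin m → Vertex m

infix 4 _~_
data _~_ {m} : Vertex m → Vertex m → Set where
  cross : ∀ {s t i j} → s ≢ t → i ≢ j → vtx s i ~ vtx t j

module _ {m : ℕ} where

  _~?_ : (v w : Vertex m) → Dec (v ~ w)
  isolated ~? w        = no λ ()
  vtx s i  ~? isolated = no λ ()
  vtx s i  ~? vtx t j  = map′ (λ (s≢t , i≢j) → cross s≢t i≢j)
    (λ { (cross s≢t i≢j) → s≢t , i≢j })
    (¬? (s Bool.≟ t) ×-dec ¬? (i Fin.≟ j))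

  ~-sym : {v w : Vertex m} → v ~ w → w ~ v
  ~-sym (cross s≢t i≢j) = cross (≢-sym s≢t) (≢-sym i≢j)

  ~-irrefl : {v : Vertex m} → ¬ v ~ v
  ~-irrefl (cross s≢s _) = s≢s refl

  ~-neighbour : ∀ {s i} {w : Vertex m} → vtx s i ~ w →
                ∃[ j ] i ≢ j × w ≡ vtx (not s) j
  ~-neighbour (cross {j = j} s≢t i≢j) =
    j , i≢j , cong (λ t → vtx t j) (Bool.¬-not (≢-sym s≢t))

  vtx-injectiveʳ : ∀ {s t} {i j : Fin m} → vtx s i ≡ vtx t j → i ≡ j
  vtx-injectiveʳ refl = refl

  vtx-injectiveˡ : ∀ {s t} {i j : Fin m} → vtx s i ≡ vtx t j → s ≡ t
  vtx-injectiveˡ refl = refl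

s≢not-s : ∀ {s} → s ≢ not s
s≢not-s = Bool.not-¬ refl

side-cases : ∀ s t → t ≡ s ⊎ t ≡ not s
side-cases s t with t Bool.≟ s
... | yes eq = inj₁ eq
... | no neq = inj₂ (Bool.¬-not neq)

-- Presents `H` as the subgraph induced on the vertices satisfying `Present`. The whole graph and
-- both kinds of vertex deletion are instances, so the strategies can be stated through labels,
-- independently of how a deletion renumbers vertices.
record InducedCopy {N} (m : ℕ) (H : Graph N) (Present : Vertex m → Set) : Set where
  field
    label           : Fin N → Vertex m
    label-injective : ∀ {u v} → label u ≡ label v → u ≡ v
    label-present   : ∀ u → Present (label u)
    index           : ∀ {v} → Present v → Fin N
    label-index     : ∀ {v} (p : Present v) → label (index p) ≡ v
    adj⇒~           : ∀ {u v} → Adj H u v → label u ~ label v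
    ~⇒adj           : ∀ {u v} → label u ~ label v → Adj H u v

module Crown {N m} {H : Graph N} {Present : Vertex m → Set}
             (copy : InducedCopy m H Present) where

  open InducedCopy copy public

  labels-differ : ∀ {u v A B} → label u ≡ A → label v ≡ B → A ≢ B → u ≢ v
  labels-differ refl refl A≢B refl = A≢B refl

  other-side : ∀ {u v s t i j} → label u ≡ vtx s i → label v ≡ vtx t j → s ≢ t → u ≢ v
  other-side eu ev s≢t = labels-differ eu ev (s≢t ∘ vtx-injectiveˡ)

  other-index : ∀ {u v s t i j} → label u ≡ vtx s i → label v ≡ vtx t j → i ≢ j → u ≢ v
  other-index eu ev i≢j = labels-differ eu ev (i≢j ∘ vtx-injectiveʳ)

  adjacent : ∀ {u v s t i j} → label u ≡ vtx s i → label v ≡ vtx t j →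
             s ≢ t → i ≢ j → Adj H u v
  adjacent {u} {v} {s} {i = i} eu ev s≢t i≢j = ~⇒adj
    (subst (_~ label v) (sym eu) (subst (vtx s i ~_) (sym ev) (cross s≢t i≢j)))

  neighbour : ∀ {u v s i} → label u ≡ vtx s i → Adj H u v →
              ∃[ j ] i ≢ j × label v ≡ vtx (not s) j
  neighbour {u} {v} eu adj = ~-neighbour (subst (_~ label v) eu (adj⇒~ adj))

  isolated-no-neighbour : ∀ {u v} → label u ≡ isolated → ¬ Adj H u v
  isolated-no-neighbour {u} {v} eu adj with subst (_~ label v) eu (adj⇒~ adj)
  ... | ()

  -- Colours kept off a side

  module _ {k : ℕ} where

    Avoids : Bool → Fin k → PartialColouring k N → Set
    Avoids s q c = ∀ u i → label u ≡ vtx s i → lookup c u ≢ just q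

    Blank : Bool → PartialColouring k N → Set
    Blank s c = ∀ u i → label u ≡ vtx s i → Uncoloured H c u

    -- On a guarded side q can never be used any more; hence it stays available
    -- for every vertex of the opposite side.
    Guarded : Bool → Fin k → PartialColouring k N → Set
    Guarded s q c = Avoids s q c ×
      (∀ u i → label u ≡ vtx s i → Uncoloured H c u → SeesColour H c u q)

    empty : PartialColouring k N
    empty = replicate N nothing

    empty-blank : ∀ s → Blank s empty
    empty-blank s u i _ = lookup-replicate u nothing

    coloured-vertex : ∀ (c : PartialColouring k N) {u v a A} → label u ≡ A → label v ≡ A →
                      ¬ Uncoloured H (c [ v ]≔ just a) u
    coloured-vertex c eu ev uncol =
      proj₁ (uncoloured-before c uncol) (label-injective (trans eu (sym ev)))

    blank⇒avoids : ∀ c {s q} → Blank s c → Avoids s q c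
    blank⇒avoids c blank u i eu eq = case trans (sym (blank u i eu)) eq of λ ()

    blank-update : ∀ c {s v a} → Blank s c → (∀ i → label v ≢ vtx s i) →
                   Blank s (c [ v ]≔ just a)
    blank-update c blank off u i eu =
      uncoloured-after c (λ { refl → off i eu }) (blank u i eu)

    avoids-update : ∀ c {s q v a} → Avoids s q c →
                    (∀ i → label v ≡ vtx s i → a ≢ q) →
                    Avoids s q (c [ v ]≔ just a)
    avoids-update c av a≢q u i eu eq with colour-before c eq
    ... | inj₁ (refl , a≡q) = a≢q i eu a≡q
    ... | inj₂ eq′          = av u i eu eq′

    avoids-update-off : ∀ c {s t j q v a} → Avoids s q c → label v ≡ vtx t j → s ≢ t →
                        Avoids s q (c [ v ]≔ just a)
    avoids-update-off c av ev s≢t = avoids-update c av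
      (λ i ev′ → ⊥-elim (s≢t (vtx-injectiveˡ (trans (sym ev′) ev))))

    avoids⇒unseen : ∀ c {s t i q v} → Avoids t q c → label v ≡ vtx s i → t ≢ s →
                    ¬ SeesColour H c v q
    avoids⇒unseen c {t = t} av ev t≢s (u , adj , eq) with neighbour ev adj | Bool.¬-not t≢s
    ... | _ , _ , eu | refl = av u _ eu eq

    -- All neighbours lie on the opposite side, so a vertex of side `s` never sees `q` and a vertex
    -- of the other side never sees `p`; the isolated vertex sees nothing.
    avoids⇒¬blocked : ∀ c {s p q} → Avoids s p c → Avoids (not s) q c → ¬ Blocked H c
    avoids⇒¬blocked c {s} {p} {q} avp avq (v , _ , sees) with label v in ev
    ... | isolated = isolated-no-neighbour ev (proj₁ (proj₂ (sees p)))
    ... | vtx t i with side-cases s t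
    ...   | inj₁ refl = avoids⇒unseen c avq ev (≢-sym s≢not-s) (sees q)
    ...   | inj₂ refl = avoids⇒unseen c avp ev s≢not-s (sees p)

    -- Every uncoloured vertex of the side sees `q`, so no legal move can put `q` there, and a
    -- colour once seen remains seen.
    guarded-update : ∀ c {s q v a} → Guarded s q c → LegalMove H c v a →
                     Guarded s q (c [ v ]≔ just a)
    guarded-update c {v = v} (av , sees) (uncol , unseen) =
      avoids-update c av (λ i ev → λ { refl → unseen (sees v i ev uncol) }) ,
      λ u i eu uncolu → sees-persists H c uncol
        (sees u i eu (proj₂ (uncoloured-before c uncolu)))

    -- A vertex is adjacent to the whole opposite side except its mate, so its colour guards that
    -- side once the mate is out of the way. The last hypothesis allows the mate to be coloured or
    -- to be missing from `H`.
    dominated : ∀ c {s t j q v} → Avoids s q c → label v ≡ vtx t j → s ≢ t →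
                lookup c v ≡ just q →
                (∀ u → label u ≡ vtx s j → ¬ Uncoloured H c u) → Guarded s q c
    dominated c av ev s≢t eq covered = av , λ u i eu uncol →
      _ , adjacent eu ev s≢t (λ { refl → covered u eu uncol }) , eq

    -- The goal of all of Alice's strategies below: once both sides are guarded, she wins whatever
    -- is played.
    guardedWins : ∀ {c s p q P} → Guarded s p c → Guarded (not s) q c → AliceWins H P c
    guardedWins {s = s} {p} {q} gp gq = invariantWins H
      (λ c → Guarded s p c × Guarded (not s) q c)
      (λ c (gp , gq) → avoids⇒¬blocked c (proj₁ gp) (proj₁ gq))
      (λ c (gp , gq) l → guarded-update c gp l , guarded-update c gq l)
      (gp , gq)

-- The degree bound

module _ {N r} {H : Graph N} {Present : Vertex (suc r) → Set}
         (copy : InducedCopy (suc r) H Present) where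

  open Crown copy

  -- A blocked vertex would have neighbours in all `suc r` colours. Sending each colour to the index
  -- of such a neighbour, with the vertex's own index skipped, would embed `Fin (suc r)` into
  -- `Fin r`.
  degree<r+1 : (c : PartialColouring (suc r) N) → ¬ Blocked H c
  degree<r+1 c (v , _ , sees) with label v in ev
  ... | isolated = isolated-no-neighbour ev (proj₁ (proj₂ (sees zero)))
  ... | vtx s i  = Fin.<⇒notInjective ℕ.≤-refl injective
    where
    mate : ∀ a → ∃[ j ] i ≢ j × label (proj₁ (sees a)) ≡ vtx (not s) j
    mate a = neighbour ev (proj₁ (proj₂ (sees a)))

    f : Fin (suc r) → Fin r
    f a = punchOut (proj₁ (proj₂ (mate a)))

    injective : ∀ {a b} → f a ≡ f b → a ≡ b
    injective {a} {b} eq = just-injective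
      (trans (sym (proj₂ (proj₂ (sees a))))
      (trans (cong (lookup c) (label-injective
        (trans (proj₂ (proj₂ (mate a)))
        (trans (cong (vtx (not s)) (Fin.punchOut-injective (proj₁ (proj₂ (mate a)))
                                      (proj₁ (proj₂ (mate b))) eq))
               (sym (proj₂ (proj₂ (mate b))))))))
             (proj₂ (proj₂ (sees b)))))

  wins-r+1 : AliceHasWinningStrategy H (suc r)
  wins-r+1 = invariantWins H (λ _ → ⊤) (λ c _ → degree<r+1 c) (λ _ _ _ → tt) tt

-- The crown without the isolated vertex

module BareCrown {N m} {H : Graph N} (copy : InducedCopy m H (_≢ isolated)) where

  open Crown copy

  at : Bool → Fin m → Fin N
  at s i = index {vtx s i} λ ()

  label-at : ∀ s i → label (at s i) ≡ vtx s i
  label-at s i = label-index _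

  at-label : ∀ {u s i} → label u ≡ vtx s i → at s i ≡ u
  at-label eu = label-injective (trans (label-at _ _) (sym eu))

  at-adjacent : ∀ {s i j} → i ≢ j → Adj H (at s i) (at (not s) j)
  at-adjacent = adjacent (label-at _ _) (label-at _ _) s≢not-s

  module _ {k : ℕ} where

    Mirrored : PartialColouring k N → Set
    Mirrored c = ∀ s i → lookup c (at s i) ≡ lookup c (at (not s) i)

    mirrored-update : ∀ c {s i a} → Mirrored c →
      Mirrored (c [ at s i ]≔ just a [ at (not s) i ]≔ just a)
    mirrored-update c {s} {i} {a} mir t j with i Fin.≟ j
    ... | no i≢j   = trans (unchanged t) (trans (mir t j) (sym (unchanged (not t))))
      where
      unchanged : ∀ t → lookup (c [ at s i ]≔ just a [ at (not s) i ]≔ just a) (at t j) ≡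
                        lookup c (at t j)
      unchanged t = trans
        (lookup∘update′ (≢-sym (other-index (label-at (not s) i) (label-at t j) i≢j))
          (c [ at s i ]≔ just a) _)
        (lookup∘update′ (≢-sym (other-index (label-at s i) (label-at t j) i≢j)) c _)
    ... | yes refl = trans (changed t) (sym (changed (not t)))
      where
      changed : ∀ t → lookup (c [ at s i ]≔ just a [ at (not s) i ]≔ just a) (at t i) ≡ just a
      changed t with side-cases s t
      ... | inj₁ refl = trans
        (lookup∘update′ (other-side (label-at s i) (label-at _ i) s≢not-s) (c [ at s i ]≔ just a) _)
        (lookup∘update (at s i) c _)
      ... | inj₂ refl = lookup∘update (at (not s) i) (c [ at s i ]≔ just a) _

    -- Bob copies each of Alice's colours onto the matched vertex, so mates agree whenever Alice is
    -- to move. At the end, equal colours at indices `i ≢ j` on one side would reappear across the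
    -- edge from `i` to the mate of `j`; hence the `m` colours on a side are distinct.
    mirror : ∀ {c} → Mirrored c → Proper H c → AliceWins H alice c → m ≤ k
    mirror {c} mir prop (finished all) = Fin.injective⇒≤ {f = f} injective
      where
      colour : ∀ s i → ∃[ x ] lookup c (at s i) ≡ just x
      colour s i = coloured c (at s i) (all (at s i))

      f : Fin m → Fin k
      f i = proj₁ (colour true i)

      injective : ∀ {i j} → f i ≡ f j → i ≡ j
      injective {i} {j} eq with i Fin.≟ j
      ... | yes i≡j = i≡j
      ... | no i≢j  = ⊥-elim (prop _ _ _ (at-adjacent i≢j)
        (proj₂ (colour true i))
        (trans (sym (mir true j)) (trans (proj₂ (colour true j)) (cong just (sym eq)))))
    mirror {c} mir prop (aliceMove _ v a l win) with label v in ev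
    ... | isolated = ⊥-elim (label-present v ev)
    ... | vtx s i with at-label ev
    mirror {c} mir prop (aliceMove _ _ a l@(uncol , unseen) win) | vtx s i | refl = respond win
      where
      c′ = c [ at s i ]≔ just a

      -- The mate was uncoloured too, by the symmetry. If one of its neighbours other than Alice's
      -- vertex had colour `a`, then so would that neighbour's mate, which is adjacent to Alice's
      -- vertex, and her move would have been illegal.
      reply : LegalMove H c′ (at (not s) i) a
      reply = uncoloured-after c (≢-sym (other-side (label-at s i) (label-at (not s) i) s≢not-s))
                (trans (sym (mir s i)) uncol) ,
              λ (u , adj , eq) → clash u adj eq
        where
        clash : ∀ u → Adj H (at (not s) i) u → lookup c′ u ≡ just a → ⊥
        clash u adj eq with neighbour (label-at (not s) i) adj | colour-before c eq
        ... | j , i≢j , eu | inj₁ (refl , _) = i≢j (vtx-injectiveʳ (trans (sym (label-at s i)) eu))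
        ... | j , i≢j , eu | inj₂ eq′ = unseen
          (at (not s) j , at-adjacent i≢j ,
           trans (sym (mir s j)) (trans (cong (lookup c) (at-label
             (trans eu (cong (λ t → vtx t j) (Bool.not-involutive s))))) eq′))

      respond : AliceWins H bob c′ → m ≤ k
      respond (finished all)  = ⊥-elim (all _ (proj₁ reply))
      respond (bobMove _ win) = mirror (mirrored-update c mir)
        (proper-update H c′ (proper-update H c prop l) reply) (win _ _ reply)

-- The whole graph

module FullCrown {N r} {H : Graph N} (copy : InducedCopy (2 + r) H (λ _ → ⊤)) where

  open Crown copy

  two-wins : AliceHasWinningStrategy H 2
  two-wins = aliceMove (avoids⇒¬blocked empty (avoid true) (avoid false)) hub zero
    (lookup-replicate hub nothing , λ (_ , adj , _) → isolated-no-neighbour hub-label adj)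
    (bobMove (avoids⇒¬blocked c₁ (blank⇒avoids c₁ {q = zero} (blank₁ true))
                                 (blank⇒avoids c₁ {q = zero} (blank₁ false))) respond)
    where
    avoid : ∀ s → Avoids {2} s zero empty
    avoid s = blank⇒avoids empty (empty-blank s)

    hub : Fin N
    hub = index {isolated} tt

    hub-label : label hub ≡ isolated
    hub-label = label-index _

    c₁ : PartialColouring 2 N
    c₁ = empty [ hub ]≔ just zero

    blank₁ : ∀ s → Blank s c₁
    blank₁ s = blank-update empty (empty-blank s) (λ i eq → case trans (sym hub-label) eq of λ ())

    respond : ∀ v x → LegalMove H c₁ v x → AliceWins H alice (c₁ [ v ]≔ just x)
    respond v x (uncol , _) with label v in ev
    ... | isolated = ⊥-elim (coloured-vertex empty ev hub-label uncol)
    ... | vtx s i  = aliceMove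
      (avoids⇒¬blocked c₂ s-avoids t-avoids) u (opposite x)
      (uncolu , avoids⇒unseen c₂ s-avoids u-label s≢not-s)
      -- Alice's colour guards Bob's side and Bob's colour guards hers: the only vertices these two
      -- fail to dominate are each other, and both are coloured.
      (guardedWins
        (dominated c₃ (avoids-update-off c₂ s-avoids u-label s≢not-s) u-label s≢not-s
          (lookup∘update u c₂ _)
          (λ w ew uncolw → coloured-vertex c₁ ew ev (proj₂ (uncoloured-before c₂ uncolw))))
        (dominated c₃ (avoids-update c₂ t-avoids (λ _ _ → opposite-≢ x)) ev (≢-sym s≢not-s)
          (colour-persists c₂ uncolu (lookup∘update v c₁ _))
          (λ w ew → coloured-vertex c₂ ew u-label)))
      where
      u : Fin N
      u = index {vtx (not s) i} tt

      u-label : label u ≡ vtx (not s) i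
      u-label = label-index _

      c₂ c₃ : PartialColouring 2 N
      c₂ = c₁ [ v ]≔ just x
      c₃ = c₂ [ u ]≔ just (opposite x)

      uncolu : Uncoloured H c₂ u
      uncolu = uncoloured-after c₁ (other-side u-label ev (≢-sym s≢not-s)) (blank₁ (not s) u i u-label)

      s-avoids : Avoids s (opposite x) c₂
      s-avoids = avoids-update c₁ (blank⇒avoids c₁ (blank₁ s)) (λ _ _ → ≢-sym (opposite-≢ x))

      t-avoids : Avoids (not s) x c₂
      t-avoids = avoids-update-off c₁ (blank⇒avoids c₁ (blank₁ (not s))) ev (≢-sym s≢not-s)

  value : χg H ≡ 2
  value = χg-unique (two-wins , λ j → edge⇒2≤k H
    (adjacent {s = true} {false} {zero} {suc zero} (label-index tt) (label-index tt) (λ ()) (λ ()))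
    (empty-proper H))

-- One vertex of the crown removed

module PuncturedCrown {N r s i} {H : Graph N}
                      (copy : InducedCopy (3 + r) H (_≢ vtx s i)) where

  open Crown copy

  t : Bool
  t = not s

  t≢s : t ≢ s
  t≢s = ≢-sym s≢not-s

  hub : Fin N
  hub = index {isolated} λ ()

  hub-label : label hub ≡ isolated
  hub-label = label-index _

  near : ∀ j → j ≢ i → Fin N
  near j j≢i = index {vtx s j} (j≢i ∘ vtx-injectiveʳ)

  near-label : ∀ {j} (j≢i : j ≢ i) → label (near j j≢i) ≡ vtx s j
  near-label j≢i = label-index _

  far : Fin (3 + r) → Fin N
  far j = index {vtx t j} (t≢s ∘ vtx-injectiveˡ)

  far-label : ∀ j → label (far j) ≡ vtx t j
  far-label j = label-index _

  centre : Fin N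
  centre = far i

  near-index-≢ : ∀ {v j} → label v ≡ vtx s j → j ≢ i
  near-index-≢ {v} ev refl = label-present v ev

  off-side : ∀ {v t₁ t₂ j} → label v ≡ vtx t₁ j → t₁ ≢ t₂ → ∀ l → label v ≢ vtx t₂ l
  off-side ev t₁≢t₂ l ev′ = t₁≢t₂ (vtx-injectiveˡ (trans (sym ev) ev′))

  off-sides : ∀ {v t₁} → label v ≡ isolated → ∀ l → label v ≢ vtx t₁ l
  off-sides ev l ev′ = case trans (sym ev) ev′ of λ ()

  -- In the crown only the far side has been played on, always with colour p.
  record Quiet (p : Fin 3) (c : PartialColouring 3 N) : Set where
    field
      centre-coloured : lookup c centre ≡ just p
      near-guarded    : Guarded s p c
      far-avoids      : ∀ q → q ≢ p → Avoids t q c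
      near-blank      : Blank s c

  open Quiet

  quiet⇒¬blocked : ∀ {p c} → Quiet p c → ¬ Blocked H c
  quiet⇒¬blocked {p} {c} quiet =
    let q , q≢p , _ = third p p
    in avoids⇒¬blocked c (proj₁ (near-guarded quiet)) (far-avoids quiet q q≢p)

  quiet-update : ∀ {p c v a} → Quiet p c → LegalMove H c v a →
                 (∀ j → label v ≢ vtx s j) → (∀ j → label v ≡ vtx t j → a ≡ p) →
                 Quiet p (c [ v ]≔ just a)
  quiet-update {c = c} quiet l@(uncol , _) not-near far-p = record
    { centre-coloured = colour-persists c uncol (centre-coloured quiet)
    ; near-guarded    = guarded-update c (near-guarded quiet) l
    ; far-avoids      = λ q q≢p → avoids-update c (far-avoids quiet q q≢p)
                          (λ j ev a≡q → q≢p (trans (sym a≡q) (far-p j ev)))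
    ; near-blank      = blank-update c (near-blank quiet) not-near
    }

  quiet-start : ∀ {p} → Quiet p (empty [ centre ]≔ just p)
  quiet-start {p} = record
    { centre-coloured = lookup∘update centre empty (just p)
    ; near-guarded    = dominated (empty [ centre ]≔ just p)
        (avoids-update-off empty (blank⇒avoids empty (empty-blank s)) (far-label i) s≢not-s)
        (far-label i) s≢not-s (lookup∘update centre empty (just p))
        -- The mate of `centre` is the deleted vertex, so `centre` dominates the entire near side by
        -- itself.
        (λ u eu _ → label-present u eu)
    ; far-avoids      = λ q q≢p → avoids-update empty (blank⇒avoids empty (empty-blank t))
        (λ _ _ p≡q → q≢p (sym p≡q))
    ; near-blank      = blank-update empty (empty-blank s) (off-side (far-label i) t≢s)
    }

  -- The near side is already guarded by `p`; a single move of Alice suffices to have the far side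
  -- guarded as well.
  answer : ∀ {p c v x} → Quiet p c → LegalMove H c v x → label v ≢ isolated →
           AliceWins H alice (c [ v ]≔ just x)
  answer {p} {c} {v} {x} quiet l@(uncol , unseen) v≢isolated with label v in ev
  ... | isolated = ⊥-elim (v≢isolated refl)
  ... | vtx t′ j with side-cases s t′
  -- Bob played on the far side, which now carries only `p` and `x`. Alice gives the third colour to
  -- the mate of his vertex; the mate is present because `centre` was already coloured and so is not
  -- Bob's vertex.
  ...   | inj₂ refl = aliceMove (avoids⇒¬blocked c₁ (proj₁ guarded₁) t-avoids) u q reply
    (guardedWins (guarded-update c₁ guarded₁ reply)
      (dominated c₂ (avoids-update-off c₁ t-avoids u-label t≢s) u-label t≢s
        (lookup∘update u c₁ _)
        (λ w ew uncolw → coloured-vertex c ew ev (proj₂ (uncoloured-before c₁ uncolw)))))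
    where
    j≢i : j ≢ i
    j≢i refl = case trans (sym uncol) (trans (cong (lookup c)
      (label-injective (trans ev (sym (far-label i))))) (centre-coloured quiet)) of λ ()

    u : Fin N
    u = near j j≢i

    u-label : label u ≡ vtx s j
    u-label = near-label j≢i

    q : Fin 3
    q = proj₁ (third p x)

    c₁ c₂ : PartialColouring 3 N
    c₁ = c [ v ]≔ just x
    c₂ = c₁ [ u ]≔ just q

    guarded₁ : Guarded s p c₁
    guarded₁ = guarded-update c (near-guarded quiet) l

    t-avoids : Avoids t q c₁
    t-avoids = avoids-update c (far-avoids quiet q (proj₁ (proj₂ (third p x))))
      (λ _ _ x≡q → proj₂ (proj₂ (third p x)) (sym x≡q))

    reply : LegalMove H c₁ u q
    reply = uncoloured-after c (other-side u-label ev s≢not-s) (near-blank quiet u j u-label) ,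
            avoids⇒unseen c₁ t-avoids u-label t≢s
  -- Bob played on the near side, necessarily with some `x ≢ p`, so his own vertex dominates the far
  -- side up to its mate `u`. Alice colours `u` with the harmless `p`, unless it is coloured
  -- already.
  ...   | inj₁ refl = finish (uncoloured? H c₁ u)
    where
    u : Fin N
    u = far j

    c₁ : PartialColouring 3 N
    c₁ = c [ v ]≔ just x

    x≢p : x ≢ p
    x≢p refl = unseen (proj₂ (near-guarded quiet) v j ev uncol)

    guarded₁ : Guarded s p c₁
    guarded₁ = guarded-update c (near-guarded quiet) l

    t-avoids : Avoids t x c₁
    t-avoids = avoids-update-off c (far-avoids quiet x x≢p) ev t≢s

    coloured₁ : lookup c₁ v ≡ just x
    coloured₁ = lookup∘update v c (just x)

    finish : Dec (Uncoloured H c₁ u) → AliceWins H alice c₁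
    finish (yes uncolu) = aliceMove (avoids⇒¬blocked c₁ (proj₁ guarded₁) t-avoids) u p reply
      (guardedWins (guarded-update c₁ guarded₁ reply)
        (dominated (c₁ [ u ]≔ just p) (avoids-update c₁ t-avoids (λ _ _ p≡x → x≢p (sym p≡x)))
          ev t≢s (colour-persists c₁ uncolu coloured₁)
          (λ w ew → coloured-vertex c₁ ew (far-label j))))
      where
      reply : LegalMove H c₁ u p
      reply = uncolu , avoids⇒unseen c₁ (proj₁ guarded₁) (far-label j) s≢not-s
    finish (no colu) = guardedWins guarded₁
      (dominated c₁ t-avoids ev t≢s coloured₁
        (λ w ew uncolw → colu (subst (Uncoloured H c₁)
          (label-injective (trans ew (sym (far-label j)))) uncolw)))

  three-wins : AliceHasWinningStrategy H 3
  three-wins = aliceMove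
    (avoids⇒¬blocked empty (blank⇒avoids empty {q = zero} (empty-blank s))
                           (blank⇒avoids empty {q = zero} (empty-blank t)))
    centre zero
    (lookup-replicate centre nothing ,
     avoids⇒unseen empty (blank⇒avoids empty (empty-blank s)) (far-label i) s≢not-s)
    (bobMove (quiet⇒¬blocked quiet₁) respond)
    where
    c₁ : PartialColouring 3 N
    c₁ = empty [ centre ]≔ just zero

    quiet₁ : Quiet zero c₁
    quiet₁ = quiet-start

    j : Fin (3 + r)
    j = proj₁ (third i i)

    respond : ∀ v x → LegalMove H c₁ v x → AliceWins H alice (c₁ [ v ]≔ just x)
    respond v x l with label v in ev
    ... | vtx _ _  = answer quiet₁ l (λ ev′ → case trans (sym ev) ev′ of λ ())
    -- Bob has used the isolated vertex to pass the turn. Alice passes it back by repeating her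
    -- colour on another far vertex, which keeps the position quiet; now Bob has to open play in the
    -- crown on other terms than `Quiet`.
    ... | isolated = aliceMove (quiet⇒¬blocked quiet₂) (far j) zero reply
      (bobMove (quiet⇒¬blocked quiet₃) λ w y l′ → answer quiet₃ l′ λ ew →
        coloured-vertex c₁ ew ev (proj₂ (uncoloured-before c₂ (proj₁ l′))))
      where
      c₂ : PartialColouring 3 N
      c₂ = c₁ [ v ]≔ just x

      quiet₂ : Quiet zero c₂
      quiet₂ = quiet-update quiet₁ l (off-sides ev) (λ l ev′ → ⊥-elim (off-sides ev l ev′))

      reply : LegalMove H c₂ (far j) zero
      reply = uncoloured-after c₁ (labels-differ (far-label j) ev λ ())
                (uncoloured-after empty
                  (other-index (far-label j) (far-label i) (proj₁ (proj₂ (third i i))))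
                  (lookup-replicate (far j) nothing)) ,
              avoids⇒unseen c₂ (proj₁ (near-guarded quiet₂)) (far-label j) s≢not-s

      quiet₃ : Quiet zero (c₂ [ far j ]≔ just zero)
      quiet₃ = quiet-update quiet₂ reply (off-side (far-label j) t≢s) (λ _ _ → refl)

  -- With two colours Bob attacks a vertex that already sees one colour by giving
  -- the other colour to another of its neighbours.

  near-far : ∀ {u v j l} → label u ≡ vtx s j → label v ≡ vtx t l → j ≢ l → Adj H u v
  near-far eu ev = adjacent eu ev s≢not-s

  far-near : ∀ {u v j l} → label u ≡ vtx t j → label v ≡ vtx s l → j ≢ l → Adj H u v
  far-near eu ev = adjacent eu ev t≢s

  -- The victim is `centre`, which is adjacent to every near vertex: Bob gives the other colour to a
  -- second near vertex.
  near-opening-loses : ∀ {v x j} → label v ≡ vtx s j →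
                       ¬ AliceWins H bob (empty {2} [ v ]≔ just x)
  near-opening-loses {v} {x} {j} ev =
    fork H (uncoloured-after empty (other-side (far-label i) ev t≢s) (lookup-replicate centre nothing))
      (far-near (far-label i) ev (≢-sym (near-index-≢ ev))) (lookup∘update v empty _)
      (far-near (far-label i) (near-label l≢i) (≢-sym l≢i))
      (uncoloured-after empty (other-index (near-label l≢i) ev l≢j)
         (lookup-replicate (near l l≢i) nothing) ,
       avoids⇒unseen (empty [ v ]≔ just x)
         (avoids-update-off empty (blank⇒avoids empty (empty-blank t)) ev t≢s)
         (near-label l≢i) t≢s)
    where
    l : Fin (3 + r)
    l = proj₁ (third i j)

    l≢i : l ≢ i
    l≢i = proj₁ (proj₂ (third i j))

    l≢j : l ≢ j
    l≢j = proj₂ (proj₂ (third i j))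

  -- Bob colours a second far vertex `far l`; the victim `near e` must exist and be matched with
  -- neither of the two coloured vertices.
  far-opening-loses : ∀ {v x j} → label v ≡ vtx t j →
                      ¬ AliceWins H bob (empty {2} [ v ]≔ just x)
  far-opening-loses {v} {x} {j} ev = play (choose (i Fin.≟ j))
    where
    Choice : Set
    Choice = ∃[ l ] ∃[ e ] l ≢ j × e ≢ i × e ≢ j × e ≢ l

    -- `e` must avoid `i`, `j` and `l`, but with only three indices guaranteed it can avoid just
    -- two; so `l` is chosen to make `i` one of `j` and `l`.
    choose : Dec (i ≡ j) → Choice
    choose (yes refl) =
      let l , l≢i , _   = third i i
          e , e≢i , e≢l = third i l
      in l , e , l≢i , e≢i , e≢i , e≢l
    choose (no i≢j) =
      let e , e≢i , e≢j = third i j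
      in i , e , i≢j , e≢i , e≢j , e≢i

    play : Choice → ¬ AliceWins H bob (empty {2} [ v ]≔ just x)
    play (l , e , l≢j , e≢i , e≢j , e≢l) =
      fork H
        (uncoloured-after empty (other-side (near-label e≢i) ev s≢not-s)
          (lookup-replicate (near e e≢i) nothing))
        (near-far (near-label e≢i) ev e≢j) (lookup∘update v empty _)
        (near-far (near-label e≢i) (far-label l) e≢l)
        (uncoloured-after empty (other-index (far-label l) ev l≢j)
           (lookup-replicate (far l) nothing) ,
         avoids⇒unseen (empty [ v ]≔ just x)
           (avoids-update-off empty (blank⇒avoids empty (empty-blank s)) ev s≢not-s)
           (far-label l) s≢not-s)

  module _ {v : Fin N} {x : Fin 2} (ev : label v ≡ isolated) where

    private
      c₁ c₂ : PartialColouring 2 N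
      c₁ = empty [ v ]≔ just x
      c₂ = c₁ [ centre ]≔ just zero

      centre-uncoloured : Uncoloured H c₁ centre
      centre-uncoloured = uncoloured-after empty (labels-differ (far-label i) ev λ ())
        (lookup-replicate centre nothing)

      near₂ : Blank s c₂
      near₂ = blank-update c₁ (blank-update empty (empty-blank s) (off-sides ev))
        (off-side (far-label i) t≢s)

      far₂ : ∀ {j} → j ≢ i → Uncoloured H c₂ (far j)
      far₂ {j} j≢i = uncoloured-after c₁ (other-index (far-label j) (far-label i) j≢i)
        (uncoloured-after empty (labels-differ (far-label j) ev λ ())
          (lookup-replicate (far j) nothing))

      centre₂ : lookup c₂ centre ≡ just zero
      centre₂ = lookup∘update centre c₁ _

    -- After Alice's waste of a move Bob takes `centre`, so all near vertices see `zero`. Whatever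
    -- Alice does next, some uncoloured near vertex can be shown, or already sees, the other colour.
    centre-reply-wins : ¬ AliceWins H alice c₂
    centre-reply-wins (finished all) =
      let j , j≢i , _ = third i i
      in all (near j j≢i) (near₂ _ j (near-label j≢i))
    centre-reply-wins (aliceMove _ w a l@(uncol , _) win) with label w in ew
    ... | isolated = coloured-vertex empty ew ev (proj₂ (uncoloured-before c₁ uncol))
    ... | vtx t′ j with side-cases s t′ | third i j
    -- Bob plays the mate `far j` of Alice's near vertex: her vertex is not adjacent to it and the
    -- rest of the near side is blank, so the other colour is legal there.
    ...   | inj₁ refl | e , e≢i , e≢j =
      fork H
        (uncoloured-after c₂ (other-index (near-label e≢i) ew e≢j) (near₂ _ e (near-label e≢i)))
        (near-far (near-label e≢i) (far-label i) e≢i) (colour-persists c₂ uncol centre₂)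
        (near-far (near-label e≢i) (far-label j) e≢j)
        (uncoloured-after c₂ (other-side (far-label j) ew t≢s) (far₂ (near-index-≢ ew)) , unseen)
        win
      where
      unseen : ¬ SeesColour H (c₂ [ w ]≔ just a) (far j) (opposite zero)
      unseen (u , adj , eq) with neighbour (far-label j) adj
      ... | l , j≢l , eu with trans eu (cong (λ t → vtx t l) (Bool.not-involutive s))
      ...   | eu′ = case trans (sym (uncoloured-after c₂ (other-index eu′ ew (≢-sym j≢l))
                       (near₂ u l eu′))) eq of λ ()
    ...   | inj₂ refl | e , e≢i , e≢j with ≡⊎≡opposite zero a
    -- Alice repeated `zero` on the far side. Bob plays `far e` against the victim `near j`, the
    -- index `j` being distinct from both `i` and `e`.
    ...     | inj₁ refl =
      fork H
        (uncoloured-after c₂ (other-side (near-label j≢i) ew s≢not-s) (near₂ _ j (near-label j≢i)))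
        (near-far (near-label j≢i) (far-label i) j≢i) (colour-persists c₂ uncol centre₂)
        (near-far (near-label j≢i) (far-label e) (≢-sym e≢j))
        (uncoloured-after c₂ (other-index (far-label e) ew e≢j) (far₂ e≢i) ,
         avoids⇒unseen (c₂ [ w ]≔ just a)
           (avoids-update-off c₂ (blank⇒avoids c₂ near₂) ew s≢not-s) (far-label e) s≢not-s)
        win
      where
      j≢i : j ≢ i
      j≢i refl = coloured-vertex c₁ ew (far-label i) uncol
    -- Alice's own move completes the block: `near e` sees both colours at once.
    ...     | inj₂ refl = blocked-loses H
      (near e e≢i ,
       uncoloured-after c₂ (other-side (near-label e≢i) ew s≢not-s) (near₂ _ e (near-label e≢i)) ,
       sees) win
      where
      sees : ∀ b → SeesColour H (c₂ [ w ]≔ just (opposite zero)) (near e e≢i) b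
      sees b with ≡⊎≡opposite zero b
      ... | inj₁ refl = centre , near-far (near-label e≢i) (far-label i) e≢i ,
                        colour-persists c₂ uncol centre₂
      ... | inj₂ refl = w , near-far (near-label e≢i) ew e≢j , lookup∘update w c₂ _

    isolated-opening-loses : ¬ AliceWins H bob c₁
    isolated-opening-loses (finished all) = all centre centre-uncoloured
    isolated-opening-loses (bobMove _ win) = centre-reply-wins
      (win centre zero (centre-uncoloured ,
        avoids⇒unseen c₁ (blank⇒avoids c₁ (blank-update empty (empty-blank s) (off-sides ev)))
          (far-label i) s≢not-s))

  two-fails : ¬ AliceHasWinningStrategy H 2
  two-fails (finished all) = all hub (lookup-replicate hub nothing)
  two-fails (aliceMove _ v x _ win) with label v in ev
  ... | isolated = isolated-opening-loses ev win
  ... | vtx t′ j with side-cases s t′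
  ...   | inj₁ refl = near-opening-loses ev win
  ...   | inj₂ refl = far-opening-loses ev win

  value : χg H ≡ 3
  value = χg-unique (three-wins , least)
    where
    least : ∀ k → AliceHasWinningStrategy H k → 3 ≤ k
    least k wins with third i i
    ... | j , j≢i , _ with ℕ.m≤n⇒m<n∨m≡n (edge⇒2≤k H
                             (near-far (near-label j≢i) (far-label i) j≢i) (empty-proper H) wins)
    ...   | inj₁ 3≤k  = 3≤k
    ...   | inj₂ refl = ⊥-elim (two-fails wins)

-- The degree bound gives one inequality; Bob's mirroring, started from the empty and hence
-- symmetric position, gives the other.
bare-value : ∀ {N r} {H : Graph N} → InducedCopy (suc r) H (_≢ isolated) → χg H ≡ suc r
bare-value {H = H} copy = χg-unique
  (wins-r+1 copy , λ k → mirror (λ s i → trans (lookup-replicate (at s i) nothing)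
                                          (sym (lookup-replicate (at (not s) i) nothing)))
                                (empty-proper H))
  where open BareCrown copy

-- The crown on numbered vertices and its deletions

vertexOf : ∀ {m} → Fin (suc (m + m)) → Vertex m
vertexOf zero        = isolated
vertexOf {m} (suc k) = [ vtx true , vtx false ]′ (splitAt m k)

indexOf : ∀ {m} → Vertex m → Fin (suc (m + m))
indexOf         isolated      = zero
indexOf {m = m} (vtx true i)  = suc (i ↑ˡ m)
indexOf {m = m} (vtx false i) = suc (m ↑ʳ i)

vertexOf-indexOf : ∀ {m} (v : Vertex m) → vertexOf (indexOf v) ≡ v
vertexOf-indexOf         isolated      = refl
vertexOf-indexOf {m = m} (vtx true i)  = cong [ vtx true , vtx false ]′ (Fin.splitAt-↑ˡ m i m)
vertexOf-indexOf {m = m} (vtx false i) = cong [ vtx true , vtx false ]′ (Fin.splitAt-↑ʳ m m i)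

indexOf-vertexOf : ∀ {m} (u : Fin (suc (m + m))) → indexOf {m} (vertexOf u) ≡ u
indexOf-vertexOf zero        = refl
indexOf-vertexOf {m} (suc k) with splitAt m k in eq
... | inj₁ i = cong suc (Fin.splitAt⁻¹-↑ˡ eq)
... | inj₂ i = cong suc (Fin.splitAt⁻¹-↑ʳ eq)

crown : ∀ m → Graph (suc (m + m))
crown m = record
  { Adj    = λ u v → vertexOf {m} u ~ vertexOf v
  ; adj?   = λ u v → vertexOf {m} u ~? vertexOf v
  ; symm   = ~-sym
  ; irrefl = λ { refl → ~-irrefl }
  }

crown-copy : ∀ m → InducedCopy m (crown m) (λ _ → ⊤)
crown-copy m = record
  { label           = vertexOf
  ; label-injective = λ {u} {v} eq →
      trans (sym (indexOf-vertexOf {m} u)) (trans (cong indexOf eq) (indexOf-vertexOf {m} v))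
  ; label-present   = λ _ → tt
  ; index           = λ {v} _ → indexOf v
  ; label-index     = λ {v} _ → vertexOf-indexOf v
  ; adj⇒~           = λ adj → adj
  ; ~⇒adj           = λ adj → adj
  }

delete : ∀ {N m v} {H : Graph (suc N)} (copy : InducedCopy m H (λ _ → ⊤)) x →
         InducedCopy.label copy x ≡ v → InducedCopy m (H ∖ x) (_≢ v)
delete {m = m} copy x refl = record
  { label           = λ u → label (punchIn x u)
  ; label-injective = λ eq → Fin.punchIn-injective x _ _ (label-injective eq)
  ; label-present   = λ u eq → Fin.punchInᵢ≢i x u (label-injective eq)
  ; index           = λ {v} v≢ → punchOut (x≢index v≢)
  ; label-index     = λ {v} v≢ →
      trans (cong label (Fin.punchIn-punchOut (x≢index v≢))) (label-index tt)
  ; adj⇒~           = adj⇒~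
  ; ~⇒adj           = ~⇒adj
  }
  where
  open InducedCopy copy

  x≢index : ∀ {v : Vertex m} → v ≢ label x → x ≢ index {v} tt
  x≢index v≢ refl = v≢ (sym (label-index tt))

-- Criticality and the set of differences

module _ (r : ℕ) where

  private
    -- For `n = suc r` this is `n + 2`, so deleting the isolated vertex gives the difference
    -- `2 - m = -n`, and any other deletion gives `2 - 3 = -1`.
    m : ℕ
    m = 3 + r

    G : Graph (suc (m + m))
    G = crown m

  χg-crown : χg G ≡ 2
  χg-crown = FullCrown.value (crown-copy m)

  χg-delete-isolated : ∀ x → vertexOf {m} x ≡ isolated → χg (G ∖ x) ≡ m
  χg-delete-isolated x eq = bare-value (delete (crown-copy m) x eq)

  χg-delete-vtx : ∀ x {s i} → vertexOf {m} x ≡ vtx s i → χg (G ∖ x) ≡ 3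
  χg-delete-vtx x eq = PuncturedCrown.value (delete (crown-copy m) x eq)

  crown-critical : UpperGameVertexCritical G
  crown-critical x with vertexOf {m} x in eq
  ... | isolated rewrite χg-crown | χg-delete-isolated x eq = s≤s (s≤s (s≤s z≤n))
  ... | vtx s i  rewrite χg-crown | χg-delete-vtx x eq      = s≤s (s≤s (s≤s z≤n))

  crown-differences : χgDifferences G ≐ ｛ - (+ 1) ｝ ∪ ｛ - (+ suc r) ｝
  crown-differences = to , from
    where
    difference : ∀ x {k} → χg (G ∖ x) ≡ k → + χg G ℤ.- + χg (G ∖ x) ≡ + 2 ℤ.- + k
    difference x eq = cong₂ (λ a b → + a ℤ.- + b) χg-crown eq

    to : ∀ {z} → χgDifferences G z → (｛ - (+ 1) ｝ ∪ ｛ - (+ suc r) ｝) z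
    to (x , refl) with vertexOf {m} x in eq
    ... | isolated = inj₂ (sym (difference x (χg-delete-isolated x eq)))
    ... | vtx s i  = inj₁ (sym (difference x (χg-delete-vtx x eq)))

    from : ∀ {z} → (｛ - (+ 1) ｝ ∪ ｛ - (+ suc r) ｝) z → χgDifferences G z
    from (inj₁ refl) = let x = indexOf {m} (vtx true zero) in
      x , sym (difference x (χg-delete-vtx x (vertexOf-indexOf {m} (vtx true zero))))
    from (inj₂ refl) = zero , sym (difference zero (χg-delete-isolated zero refl))

proposition7 : ∀ (n : ℕ) → n ≥ 1 →
    ∃[ m ] Σ[ G ∈ Graph m ]
    UpperGameVertexCritical G × χgDifferences G ≐ ｛ - (+ 1) ｝ ∪ ｛ - (+ n) ｝
proposition7 (suc r) _ = _ , crown (3 + r) , crown-critical r , crown-differences r
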